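{- The sequence $b_{1,2}(n)$ satisfies $b_{1,2}(1)=0$, $b_{1,2}(2)=1$, and for every integer $n\ge3$, $$b_{1,2}(n)=b_{1,2}(n-1)+b_{1,2}\left(\left\lfloor \tfrac{n+1}{2}\right\rfloor\right)+b_{1,2}\left(\left\lceil \tfrac{n+1}{2}\right\rceil\right).$$
   Context: A partition $\lambda=(\lambda_1,\dots,\lambda_\ell)$ of $n$ is a weakly decreasing sequence of positive integers with sum $n$, identified with its multiset of parts; $\ell(\lambda)=\ell$ is its length. A binary partition is a partition all of whose parts are powers of $2$ (including $2^0=1$), and $\mathcal B(n)$ is the set of binary partitions of $n$. For a partition $\lambda$ with $\ell(\lambda)\ge2$, $\mathrm{pre}_2(\lambda)$ is the partition whose multiset of parts is $\{\lambda_i\lambda_k\mid 1\le i<k\le\ell(\lambda)\}$ (with multiplicity, one part for each pair $i<k$); if $\ell(\lambda)<2$, $\mathrm{pre}_2(\lambda)=\emptyset$. $\mathrm{pre}_2(\mathcal B(n))$ is the set of partitions $\mathrm{pre}_2(\lambda)$ with $\lambda\in\mathcal B(n)$. $b_{1,2}(n)$ is the total number of parts equal to $1$ (counted with multiplicity) in all partitions in $\mathrm{pre}_2(\mathcal B(n))$. -}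

module Defs where

open import Data.List using (List; []; _∷_; _++_; map; filter; length; upTo; deduplicate; cartesianProductWith)
open import Data.List.Membership.Propositional using (_∈_)
open import Data.List.Membership.Propositional.Properties
  using (∈-cartesianProductWith⁺; ∈-filter⁺; ∈-filter⁻; ∈-map⁺; ∈-map⁻; ∈-upTo⁺; ∈-deduplicate⁺; ∈-deduplicate⁻)
open import Data.List.Properties using (≡-dec)
open import Data.List.Relation.Unary.All as All using (All; []; _∷_)
open import Data.List.Relation.Unary.Any using (here; there)
open import Data.List.Relation.Unary.Linked as Linked using (Linked)
open import Data.List.Relation.Unary.Unique.Propositional using (Unique)
import Data.List.Relation.Unary.Unique.DecPropositional.Properties as DecUnique
import Data.List.Sort.InsertionSort as InsertionSort
open import Data.Nat using (ℕ; zero; suc; _+_; _*_; _^_; _≤_; _<_; _>_; _≥_; z≤n; s≤s; _≟_; _>?_; _≥?_)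
open import Data.Nat.ListAction using (sum)
open import Data.Nat.Properties using (≤-decTotalOrder; ≤-trans; ≤-reflexive; m≤m+n; m≤n+m; +-mono-≤; m^n>0; anyUpTo?)
open import Data.Product using (∃; _×_; _,_; proj₁; proj₂)
open import Function using (_⇔_; mk⇔; Equivalence)
open import Relation.Binary.Construct.Flip.EqAndOrd using (decTotalOrder)
open import Relation.Binary.PropositionalEquality using (_≡_; refl; sym; subst)
open import Relation.Nullary.Decidable using (map′; _×-dec_)
open import Relation.Unary using (Decidable)

open DecUnique (≡-dec _≟_) using (deduplicate-!)
open InsertionSort (decTotalOrder ≤-decTotalOrder) using () renaming (sort to sort↓)

record IsPartition (n : ℕ) (xs : List ℕ) : Set where
  constructor isPartition
  field
    positive   : All (_> 0) xs
    decreasing : Linked _≥_ xs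
    sum≡       : sum xs ≡ n

IsPowerOf2 : ℕ → Set
IsPowerOf2 m = ∃ λ k → m ≡ 2 ^ k

record IsBinaryPartition (n : ℕ) (xs : List ℕ) : Set where
  constructor isBinaryPartition
  field
    partition : IsPartition n xs
    powersOf2 : All IsPowerOf2 xs

isPowerOf2? : Decidable IsPowerOf2
isPowerOf2? m = map′ (λ (k , _ , m≡2^k) → k , m≡2^k)
                     (λ (k , m≡2^k) → k , subst (k <_) (sym m≡2^k) (k<2^k k) , m≡2^k)
                     (anyUpTo? (λ k → m ≟ 2 ^ k) m)
  where
  k<2^k : ∀ k → k < 2 ^ k
  k<2^k zero    = s≤s z≤n
  k<2^k (suc k) = +-mono-≤ (m^n>0 2 k) (≤-trans (k<2^k k) (m≤m+n (2 ^ k) 0))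

isPartition? : ∀ n → Decidable (IsPartition n)
isPartition? n xs = map′ (λ (p , d , s) → isPartition p d s)
                         (λ (isPartition p d s) → p , d , s)
                         (All.all? (_>? 0) xs ×-dec Linked.linked? _≥?_ xs ×-dec (sum xs ≟ n))

isBinaryPartition? : ∀ n → Decidable (IsBinaryPartition n)
isBinaryPartition? n xs = map′ (λ (p , b) → isBinaryPartition p b)
                               (λ (isBinaryPartition p b) → p , b)
                               (isPartition? n xs ×-dec All.all? isPowerOf2? xs)

-- All lists of length at most k with entries at most m.
boundedLists : (k m : ℕ) → List (List ℕ)
boundedLists zero    m = [] ∷ []
boundedLists (suc k) m = [] ∷ cartesianProductWith _∷_ (upTo (suc m)) (boundedLists k m)

-- A partition of n has at most n parts, each at most n, so the search
-- below misses none.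
binaryPartitions : ℕ → List (List ℕ)
binaryPartitions n = filter (isBinaryPartition? n) (boundedLists n n)

∈-binaryPartitions : ∀ n {xs} → xs ∈ binaryPartitions n ⇔ IsBinaryPartition n xs
∈-binaryPartitions n = mk⇔
  (λ xs∈ → proj₂ (∈-filter⁻ (isBinaryPartition? n) {xs = boundedLists n n} xs∈))
  (λ b → ∈-filter⁺ (isBinaryPartition? n) (bounded b) b)
  where
  ∈-boundedLists : ∀ {k m} xs → length xs ≤ k → All (_≤ m) xs → xs ∈ boundedLists k m
  ∈-boundedLists {zero}  []       _       _        = here refl
  ∈-boundedLists {suc k} []       _       _        = here refl
  ∈-boundedLists {suc k} (x ∷ xs) (s≤s l) (p ∷ ps) =
    there (∈-cartesianProductWith⁺ _∷_ (∈-upTo⁺ (s≤s p)) (∈-boundedLists xs l ps))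

  length≤sum : ∀ {xs} → All (_> 0) xs → length xs ≤ sum xs
  length≤sum []       = z≤n
  length≤sum (p ∷ ps) = +-mono-≤ p (length≤sum ps)

  parts≤sum : ∀ xs → All (_≤ sum xs) xs
  parts≤sum []       = []
  parts≤sum (x ∷ xs) = m≤m+n x (sum xs) ∷ All.map (λ p → ≤-trans p (m≤n+m (sum xs) x)) (parts≤sum xs)

  bounded : ∀ {xs} → IsBinaryPartition n xs → xs ∈ boundedLists n n
  bounded {xs} (isBinaryPartition (isPartition pos _ s) _) =
    ∈-boundedLists xs (≤-trans (length≤sum pos) (≤-reflexive s))
                      (All.map (λ p → ≤-trans p (≤-reflexive s)) (parts≤sum xs))

-- The products λᵢ λₖ, one for each pair of positions i < k.
pairProducts : List ℕ → List ℕ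
pairProducts []       = []
pairProducts (x ∷ xs) = map (x *_) xs ++ pairProducts xs

-- Sorting into weakly decreasing order makes equality of lists coincide
-- with equality of partitions (multisets of parts).
pre₂ : List ℕ → List ℕ
pre₂ xs = sort↓ (pairProducts xs)

-- pre₂(𝓑(n)) is a set of partitions: a partition arising from several
-- elements of 𝓑(n) is listed once.
pre₂-binaryPartitions : ℕ → List (List ℕ)
pre₂-binaryPartitions n = deduplicate (≡-dec _≟_) (map pre₂ (binaryPartitions n))

pre₂-binaryPartitions-unique : ∀ n → Unique (pre₂-binaryPartitions n)
pre₂-binaryPartitions-unique n = deduplicate-! (map pre₂ (binaryPartitions n))

∈-pre₂-binaryPartitions : ∀ n {ys} →
  ys ∈ pre₂-binaryPartitions n ⇔ (∃ λ xs → IsBinaryPartition n xs × ys ≡ pre₂ xs)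
∈-pre₂-binaryPartitions n = mk⇔
  (λ ys∈ → let xs , xs∈ , eq = ∈-map⁻ pre₂ (∈-deduplicate⁻ (≡-dec _≟_) (map pre₂ (binaryPartitions n)) ys∈)
           in xs , Equivalence.to (∈-binaryPartitions n) xs∈ , eq)
  (λ { (xs , b , refl) → ∈-deduplicate⁺ (≡-dec _≟_) (∈-map⁺ pre₂ (Equivalence.from (∈-binaryPartitions n) b)) })

multiplicity : ℕ → List ℕ → ℕ
multiplicity i xs = length (filter (_≟ i) xs)

b₁,₂ : ℕ → ℕ
b₁,₂ n = sum (map (multiplicity 1) (pre₂-binaryPartitions n))

{-# OPTIONS --safe #-}
-- The sum of λ together with the multiset pre₂(λ) determines λ: squaring the
-- sum gives the sum of squares, the squares of the parts have pre₂ known as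
-- well, so all power sums of exponent 2ʲ are known, and the largest part is read
-- off from their growth.  Hence pre₂ is injective on 𝓑(n), and b₁,₂(n) = c(n) is
-- the sum of m₁(λ) C 2 over 𝓑(n), where m₁ counts the parts equal to 1.
--
-- Removing a part 1, or halving all parts if there is none, decomposes 𝓑(n + 1).
-- With u(n) = Σ m₁(λ) and β(n) = |𝓑(n)| this gives c(n + 1) = c(n) + u(n),
-- u(n + 1) = u(n) + β(n) and β(n + 2) = β(n) + β(⌊n/2⌋ + 1), hence first
-- β(n) = u(⌊n/2⌋ + 1) and then u(n) = c(⌊n/2⌋ + 1) + c(⌈n/2⌉ + 1).
module Submission where

open import Defs
open import Data.List using (List; []; _∷_; _++_; _∷ʳ_; map; filter; length; upTo; cartesianProductWith)
open import Data.List.Membership.Propositional using (_∈_)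
open import Data.List.Membership.Propositional.Properties using (∈-cartesianProductWith⁻; ∈-map⁺; ∈-map⁻; ∈-++⁺ˡ; ∈-++⁺ʳ; ∈-++⁻; ∈-deduplicate⁺; ∈-deduplicate⁻)
open import Data.List.Membership.Propositional.Properties.WithK using (unique∧set⇒bag)
open import Data.List.Properties using (≡-dec; map-cong; map-∘; map-id; map-++; map-injective; filter-reject; filter-none; filter-++; length-++; ∷-injective; ∷ʳ-injectiveˡ)
open import Data.List.Relation.Binary.BagAndSetEquality using (∼bag⇒↭)
open import Data.List.Relation.Binary.Permutation.Propositional using (_↭_; ↭-sym; ↭-trans; ↭-reflexive)
import Data.List.Relation.Binary.Permutation.Propositional.Properties as ↭
open import Data.List.Relation.Unary.All as All using (All; []; _∷_)
import Data.List.Relation.Unary.All.Properties as All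
open import Data.List.Relation.Unary.AllPairs using ([]; _∷_)
open import Data.List.Relation.Unary.Linked as Linked using (Linked; []; [-]; _∷_)
import Data.List.Relation.Unary.Linked.Properties as Linked
open import Data.List.Relation.Unary.Unique.Propositional using (Unique)
import Data.List.Relation.Unary.Unique.Propositional.Properties as Unique
open import Data.List.Sort.Base using (module SortingAlgorithm)
import Data.List.Sort.InsertionSort as InsertionSort
open import Data.Nat using (ℕ; zero; suc; _+_; _*_; _∸_; _^_; _≤_; _<_; _>_; _≥_; z≤n; s≤s; _≟_; ⌊_/2⌋; ⌈_/2⌉)
open import Data.Nat.Combinatorics using (_C_; nC1≡n; nCk+nC[k+1]≡[n+1]C[k+1])
open import Data.Nat.ListAction using (sum)
open import Data.Nat.ListAction.Properties using (sum-++; sum-↭)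
open import Data.Nat.Properties
open import Algebra.Properties.CommutativeSemigroup +-commutativeSemigroup using (xy∙z≈xz∙y; interchange)
open import Data.Nat.Tactic.RingSolver using (solve-∀)
open import Data.Product using (∃; _×_; _,_; proj₁; proj₂)
open import Data.Sum as Sum using (_⊎_; inj₁; inj₂)
open import Function using (_∘_; const; id; flip; mk⇔; Equivalence)
open import Relation.Binary.Construct.Flip.EqAndOrd using (decTotalOrder)
open import Relation.Binary.Definitions using (tri<; tri≈; tri>)
open import Relation.Binary.PropositionalEquality using (_≡_; _≢_; _≗_; refl; sym; trans; cong; cong₂; subst; module ≡-Reasoning)
open import Relation.Nullary using (¬_; yes; no; contradiction)

private
  variable
    A B : Set
    m n : ℕ
    xs ys : List ℕ

-- Lists without repetition, up to permutation

unique∧set⇒↭ : {xs ys : List A} → Unique xs → Unique ys →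
               (∀ {z} → z ∈ xs → z ∈ ys) → (∀ {z} → z ∈ ys → z ∈ xs) → xs ↭ ys
unique∧set⇒↭ xs! ys! ⊆ ⊇ = ∼bag⇒↭ (unique∧set⇒bag xs! ys! (mk⇔ ⊆ ⊇))

-- Injectivity is asked for on `P` only, because `pre₂` is injective just among partitions of one
-- and the same number.
map-unique-local : {P : A → Set} {f : A → B} → (∀ {x y} → P x → P y → f x ≡ f y → x ≡ y) →
                   {xs : List A} → All P xs → Unique xs → Unique (map f xs)
map-unique-local inj []         []           = []
map-unique-local inj (px ∷ pxs) (x∉xs ∷ xs!) =
  All.map⁺ (All.zipWith (λ (py , x≢y) eq → x≢y (inj px py eq)) (pxs , x∉xs))
  ∷ map-unique-local inj pxs xs!

-- Power sums

powerSum : ℕ → List ℕ → ℕ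
powerSum k xs = sum (map (_^ k) xs)

sum-map-* : ∀ a xs → sum (map (a *_) xs) ≡ a * sum xs
sum-map-* a []       = sym (*-zeroʳ a)
sum-map-* a (x ∷ xs) = trans (cong (a * x +_) (sum-map-* a xs)) (sym (*-distribˡ-+ a x (sum xs)))

-- In the expanded square each product of two different positions occurs twice and each position
-- contributes its own square once. This recovers the sum of squares from the sum and the pair
-- products.
sum-squared : ∀ xs → sum xs * sum xs ≡ powerSum 2 xs + 2 * sum (pairProducts xs)
sum-squared []       = refl
sum-squared (x ∷ xs) = begin
  (x + sum xs) * (x + sum xs)
    ≡⟨ expand x (sum xs) ⟩
  x ^ 2 + 2 * (x * sum xs) + sum xs * sum xs
    ≡⟨ cong₂ (λ a b → x ^ 2 + 2 * a + b) (sym (sum-map-* x xs)) (sum-squared xs) ⟩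
  x ^ 2 + 2 * sum (map (x *_) xs) + (powerSum 2 xs + 2 * sum (pairProducts xs))
    ≡⟨ regroup (x ^ 2) (sum (map (x *_) xs)) (powerSum 2 xs) (sum (pairProducts xs)) ⟩
  x ^ 2 + powerSum 2 xs + 2 * (sum (map (x *_) xs) + sum (pairProducts xs))
    ≡⟨ cong (λ a → x ^ 2 + powerSum 2 xs + 2 * a) (sum-++ (map (x *_) xs) (pairProducts xs)) ⟨
  x ^ 2 + powerSum 2 xs + 2 * sum (map (x *_) xs ++ pairProducts xs) ∎
  where
  open ≡-Reasoning
  expand : ∀ x s → (x + s) * (x + s) ≡ x * (x * 1) + 2 * (x * s) + s * s
  expand = solve-∀
  regroup : ∀ a b c d → a + 2 * b + (c + 2 * d) ≡ a + c + 2 * (b + d)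
  regroup = solve-∀

pairProducts-squares : ∀ xs → pairProducts (map (_^ 2) xs) ≡ map (_^ 2) (pairProducts xs)
pairProducts-squares []       = refl
pairProducts-squares (x ∷ xs) = begin
  map (x ^ 2 *_) (map (_^ 2) xs) ++ pairProducts (map (_^ 2) xs)
    ≡⟨ cong₂ _++_ (map-∘ xs) (sym (pairProducts-squares xs)) ⟨
  map (λ y → x ^ 2 * y ^ 2) xs ++ map (_^ 2) (pairProducts xs)
    ≡⟨ cong (_++ map (_^ 2) (pairProducts xs)) (trans (map-cong (square-* x) xs) (map-∘ xs)) ⟩
  map (_^ 2) (map (x *_) xs) ++ map (_^ 2) (pairProducts xs)
    ≡⟨ map-++ (_^ 2) (map (x *_) xs) (pairProducts xs) ⟨
  map (_^ 2) (map (x *_) xs ++ pairProducts xs) ∎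
  where
  open ≡-Reasoning
  square-* : ∀ x y → x * (x * 1) * (y * (y * 1)) ≡ x * y * (x * y * 1)
  square-* = solve-∀

powerSum-1 : ∀ xs → powerSum 1 xs ≡ sum xs
powerSum-1 xs = cong sum (trans (map-cong ^-identityʳ xs) (map-id xs))

powerSum-squares : ∀ k xs → powerSum k (map (_^ 2) xs) ≡ powerSum (2 * k) xs
powerSum-squares k xs = cong sum (trans (sym (map-∘ xs)) (map-cong (λ x → ^-*-assoc x 2 k) xs))

-- Induction on `j` for all lists at once: both hypotheses pass from the parts to their squares, and
-- the power sum of exponent `2 ^ j` of the squares is the one of exponent `2 ^ suc j` of the parts.
powerSum-2^ : ∀ j xs ys → sum xs ≡ sum ys → pairProducts xs ↭ pairProducts ys →
              powerSum (2 ^ j) xs ≡ powerSum (2 ^ j) ys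
powerSum-2^ zero    xs ys s p = trans (powerSum-1 xs) (trans s (sym (powerSum-1 ys)))
powerSum-2^ (suc j) xs ys s p = begin
  powerSum (2 ^ suc j) xs          ≡⟨ powerSum-squares (2 ^ j) xs ⟨
  powerSum (2 ^ j) (map (_^ 2) xs) ≡⟨ powerSum-2^ j (map (_^ 2) xs) (map (_^ 2) ys) squares≡ products↭ ⟩
  powerSum (2 ^ j) (map (_^ 2) ys) ≡⟨ powerSum-squares (2 ^ j) ys ⟩
  powerSum (2 ^ suc j) ys          ∎
  where
  open ≡-Reasoning
  squares≡ : powerSum 2 xs ≡ powerSum 2 ys
  squares≡ = +-cancelʳ-≡ (2 * sum (pairProducts xs)) _ _ (begin
    powerSum 2 xs + 2 * sum (pairProducts xs) ≡⟨ sum-squared xs ⟨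
    sum xs * sum xs                           ≡⟨ cong₂ _*_ s s ⟩
    sum ys * sum ys                           ≡⟨ sum-squared ys ⟩
    powerSum 2 ys + 2 * sum (pairProducts ys) ≡⟨ cong (λ a → powerSum 2 ys + 2 * a) (sum-↭ p) ⟨
    powerSum 2 ys + 2 * sum (pairProducts xs) ∎)
  products↭ : pairProducts (map (_^ 2) xs) ↭ pairProducts (map (_^ 2) ys)
  products↭ = ↭-trans (↭-reflexive (pairProducts-squares xs))
             (↭-trans (↭.map⁺ (_^ 2) p) (↭-reflexive (sym (pairProducts-squares ys))))

-- Bernoulli's inequality (1 + 1/y)^k ≥ 1 + k/y without denominators.
bernoulli : ∀ y k → y ^ k * (y + k) ≤ y * suc y ^ k
bernoulli y zero    = ≤-reflexive (trans (*-identityˡ (y + 0)) (trans (+-identityʳ y) (sym (*-identityʳ y))))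
bernoulli y (suc k) = begin
  y * y ^ k * (y + suc k)             ≡⟨ left y (y ^ k) k ⟩
  y * (y ^ k * (y + k)) + y * y ^ k   ≤⟨ +-mono-≤ (*-monoʳ-≤ y (bernoulli y k)) (*-monoʳ-≤ y (^-monoˡ-≤ k (n≤1+n y))) ⟩
  y * (y * suc y ^ k) + y * suc y ^ k ≡⟨ right y (suc y ^ k) ⟩
  y * (suc y * suc y ^ k)             ∎
  where
  open ≤-Reasoning
  left : ∀ y a k → y * a * (y + (1 + k)) ≡ y * (a * (y + k)) + y * a
  left = solve-∀
  right : ∀ y b → y * (y * b) + y * b ≡ y * ((1 + y) * b)
  right = solve-∀

-- Since x / y ≥ 1 + 1 / y, Bernoulli gives (x / y) ^ k ≥ 1 + k / y, which exceeds `c` as soon as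
-- `k` reaches `c * y`.
*^<^ : ∀ {x y} c k → 0 < y → y < x → c * y ≤ k → c * y ^ k < x ^ k
*^<^ {x} {y@(suc _)} c k _ y<x cy≤k = *-cancelˡ-< y _ _ (begin-strict
  y * (c * y ^ k) ≡⟨ rearrange y c (y ^ k) ⟩
  y ^ k * (c * y) <⟨ *-monoʳ-< (y ^ k) {{m^n≢0 y k}} (+-mono-≤ {1} {y} {c * y} (s≤s z≤n) cy≤k) ⟩
  y ^ k * (y + k) ≤⟨ bernoulli y k ⟩
  y * suc y ^ k   ≤⟨ *-monoʳ-≤ y (^-monoˡ-≤ k y<x) ⟩
  y * x ^ k       ∎)
  where
  open ≤-Reasoning
  rearrange : ∀ y c a → y * (c * a) ≡ a * (c * y)
  rearrange = solve-∀

powerSum-≤ : ∀ k {y} → All (_≤ y) ys → powerSum k ys ≤ length ys * y ^ k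
powerSum-≤ k []       = z≤n
powerSum-≤ k (p ∷ ps) = +-mono-≤ (^-monoˡ-≤ k p) (powerSum-≤ k ps)

n<2^n : ∀ n → n < 2 ^ n
n<2^n zero    = s≤s z≤n
n<2^n (suc n) = +-mono-≤ (m^n>0 2 n) (≤-trans (n<2^n n) (m≤m+n (2 ^ n) 0))

-- The head `y` bounds every part of its list, so for a large exponent the single term of `x`
-- outweighs all of them together.
larger-head : ∀ {x y} → y < x → 0 < y → Linked _≥_ (y ∷ ys) →
              ∃ λ j → powerSum (2 ^ j) (y ∷ ys) < powerSum (2 ^ j) (x ∷ xs)
larger-head {ys} {xs} {x} {y} y<x 0<y y∷ys↘ = j , (begin-strict
  powerSum (2 ^ j) (y ∷ ys)     ≤⟨ powerSum-≤ (2 ^ j) (Linked.Linked⇒All (flip ≤-trans) (≤-refl {y}) y∷ys↘) ⟩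
  length (y ∷ ys) * y ^ (2 ^ j) <⟨ *^<^ (length (y ∷ ys)) (2 ^ j) 0<y y<x (<⇒≤ (n<2^n j)) ⟩
  x ^ (2 ^ j)                   ≤⟨ m≤m+n _ _ ⟩
  powerSum (2 ^ j) (x ∷ xs)     ∎)
  where
  open ≤-Reasoning
  -- `*^<^` needs an exponent of at least this number; the exponent is `2 ^ j`, and `j < 2 ^ j`.
  j = length (y ∷ ys) * y

-- Different heads would separate some power sum by `larger-head`. Equal heads cancel from every
-- power sum, which leaves the tails.
powerSums-injective : Linked _≥_ xs → Linked _≥_ ys → All (_> 0) xs → All (_> 0) ys →
                      (∀ j → powerSum (2 ^ j) xs ≡ powerSum (2 ^ j) ys) → xs ≡ ys
powerSums-injective {[]}    {[]}    _ _ _ _ _ = refl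
powerSums-injective {[]}    {y ∷ ys} _ _ _ (0<y ∷ _) eq =
  -- Exponent `2 ^ 0` compares the plain sums: zero against a positive number.
  contradiction (≤-trans (m≤m+n y _) (≤-reflexive (sym (trans (eq 0) (powerSum-1 (y ∷ ys)))))) (<⇒≱ 0<y)
powerSums-injective {x ∷ xs} {[]}    _ _ (0<x ∷ _) _ eq =
  contradiction (≤-trans (m≤m+n x _) (≤-reflexive (trans (sym (powerSum-1 (x ∷ xs))) (eq 0)))) (<⇒≱ 0<x)
powerSums-injective {x ∷ xs} {y ∷ ys} xs↘ ys↘ (0<x ∷ xs>0) (0<y ∷ ys>0) eq with <-cmp x y
... | tri< x<y _ _ = let j , lt = larger-head {xs = ys} x<y 0<x xs↘ in contradiction (eq j) (<⇒≢ lt)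
... | tri> _ _ y<x = let j , lt = larger-head {xs = xs} y<x 0<y ys↘ in contradiction (sym (eq j)) (<⇒≢ lt)
... | tri≈ _ refl _ = cong (x ∷_) (powerSums-injective (Linked.tail xs↘) (Linked.tail ys↘) xs>0 ys>0
                                    (λ j → +-cancelˡ-≡ (x ^ (2 ^ j)) _ _ (eq j)))

-- Injectivity of `pre₂` and the enumeration of its image

pre₂-↭ : ∀ xs → pre₂ xs ↭ pairProducts xs
pre₂-↭ xs = SortingAlgorithm.sort-↭ (InsertionSort.insertionSort (decTotalOrder ≤-decTotalOrder)) (pairProducts xs)

-- The common `n` supplies the equality of sums. The pair products alone would not suffice: every
-- one-part partition has none.
pre₂-injective : IsPartition n xs → IsPartition n ys → pre₂ xs ≡ pre₂ ys → xs ≡ ys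
pre₂-injective {xs = xs} {ys} (isPartition xs>0 xs↘ Σxs) (isPartition ys>0 ys↘ Σys) eq =
  powerSums-injective xs↘ ys↘ xs>0 ys>0 λ j → powerSum-2^ j xs ys (trans Σxs (sym Σys))
    (↭-trans (↭-sym (pre₂-↭ xs)) (↭-trans (↭-reflexive eq) (pre₂-↭ ys)))

boundedLists-unique : ∀ k m → Unique (boundedLists k m)
boundedLists-unique zero    m = [] ∷ []
boundedLists-unique (suc k) m =
  All.tabulate []∉ ∷ Unique.cartesianProductWith⁺ _∷_ ∷-injective (Unique.upTo⁺ (suc m)) (boundedLists-unique k m)
  where
  []∉ : ∀ {zs} → zs ∈ cartesianProductWith _∷_ (upTo (suc m)) (boundedLists k m) → [] ≢ zs
  -- The last component of the decomposition would equate `[]` with a cons.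
  []∉ zs∈ refl with () ← ∈-cartesianProductWith⁻ _∷_ (upTo (suc m)) (boundedLists k m) zs∈ .proj₂ .proj₂ .proj₂ .proj₂

binaryPartitions-unique : ∀ n → Unique (binaryPartitions n)
binaryPartitions-unique n = Unique.filter⁺ (isBinaryPartition? n) (boundedLists-unique n n)

-- By injectivity the images are already distinct, so deduplication loses no multiplicity.
pre₂-binaryPartitions-↭ : ∀ n → pre₂-binaryPartitions n ↭ map pre₂ (binaryPartitions n)
pre₂-binaryPartitions-↭ n = unique∧set⇒↭ (pre₂-binaryPartitions-unique n) unique
  (∈-deduplicate⁻ (≡-dec _≟_) (map pre₂ (binaryPartitions n))) (∈-deduplicate⁺ (≡-dec _≟_))
  where
  unique : Unique (map pre₂ (binaryPartitions n))
  unique = map-unique-local (pre₂-injective {n})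
    (All.tabulate (IsBinaryPartition.partition ∘ Equivalence.to (∈-binaryPartitions n)))
    (binaryPartitions-unique n)

-- Parts equal to 1

multiplicity-↭ : ∀ i → xs ↭ ys → multiplicity i xs ≡ multiplicity i ys
multiplicity-↭ i p = ↭.↭-length (↭.filter-↭ (_≟ i) p)

multiplicity-++ : ∀ i xs ys → multiplicity i (xs ++ ys) ≡ multiplicity i xs + multiplicity i ys
multiplicity-++ i xs ys = trans (cong length (filter-++ (_≟ i) xs ys)) (length-++ (filter (_≟ i) xs))

multiplicity-1-map-* : ∀ {a} → a ≢ 1 → ∀ xs → multiplicity 1 (map (a *_) xs) ≡ 0
multiplicity-1-map-* {a} a≢1 xs =
  cong length (filter-none (_≟ 1) (All.map⁺ (All.universal (λ x → a≢1 ∘ m*n≡1⇒m≡1 a x) xs)))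

multiplicity-1-∷ʳ : ∀ xs → multiplicity 1 (xs ∷ʳ 1) ≡ suc (multiplicity 1 xs)
multiplicity-1-∷ʳ xs = trans (multiplicity-++ 1 xs (1 ∷ [])) (+-comm (multiplicity 1 xs) 1)

n+nC2≡[n+1]C2 : ∀ n → n + n C 2 ≡ suc n C 2
n+nC2≡[n+1]C2 n = trans (cong (_+ n C 2) (sym (nC1≡n n))) (nCk+nC[k+1]≡[n+1]C[k+1] n 1)

-- A product of naturals is 1 only if both factors are, so pairs of ones are being counted. A new
-- head 1 forms one such pair with each later 1, which is Pascal's rule; any other head forms none.
multiplicity-1-pairProducts : ∀ xs → multiplicity 1 (pairProducts xs) ≡ multiplicity 1 xs C 2
multiplicity-1-pairProducts []       = refl
multiplicity-1-pairProducts (x ∷ xs) with x ≟ 1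
... | yes refl = begin
  multiplicity 1 (map (1 *_) xs ++ pairProducts xs)
    ≡⟨ multiplicity-++ 1 (map (1 *_) xs) (pairProducts xs) ⟩
  multiplicity 1 (map (1 *_) xs) + multiplicity 1 (pairProducts xs)
    ≡⟨ cong₂ _+_ (cong (multiplicity 1) (trans (map-cong *-identityˡ xs) (map-id xs))) (multiplicity-1-pairProducts xs) ⟩
  multiplicity 1 xs + multiplicity 1 xs C 2
    ≡⟨ n+nC2≡[n+1]C2 (multiplicity 1 xs) ⟩
  suc (multiplicity 1 xs) C 2 ∎
  where open ≡-Reasoning
... | no x≢1 = begin
  multiplicity 1 (map (x *_) xs ++ pairProducts xs)
    ≡⟨ multiplicity-++ 1 (map (x *_) xs) (pairProducts xs) ⟩
  multiplicity 1 (map (x *_) xs) + multiplicity 1 (pairProducts xs)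
    ≡⟨ cong₂ _+_ (multiplicity-1-map-* x≢1 xs) (multiplicity-1-pairProducts xs) ⟩
  multiplicity 1 xs C 2
    ≡⟨ cong ((_C 2) ∘ length) (filter-reject (_≟ 1) x≢1) ⟨
  multiplicity 1 (x ∷ xs) C 2 ∎
  where open ≡-Reasoning

-- The weight is arbitrary so that the decomposition is summed once and then specialised to `β`, `u`
-- and `c`.
onesSum : (ℕ → ℕ) → ℕ → ℕ
onesSum f n = sum (map (f ∘ multiplicity 1) (binaryPartitions n))

b₁,₂≡onesSum : ∀ n → b₁,₂ n ≡ onesSum (_C 2) n
b₁,₂≡onesSum n = begin
  sum (map (multiplicity 1) (pre₂-binaryPartitions n))       ≡⟨ sum-↭ (↭.map⁺ (multiplicity 1) (pre₂-binaryPartitions-↭ n)) ⟩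
  sum (map (multiplicity 1) (map pre₂ (binaryPartitions n))) ≡⟨ cong sum (map-∘ (binaryPartitions n)) ⟨
  sum (map (multiplicity 1 ∘ pre₂) (binaryPartitions n))     ≡⟨ cong sum (map-cong pairs (binaryPartitions n)) ⟩
  onesSum (_C 2) n                                           ∎
  where
  open ≡-Reasoning
  pairs : multiplicity 1 ∘ pre₂ ≗ (_C 2) ∘ multiplicity 1
  pairs xs = trans (multiplicity-↭ 1 (pre₂-↭ xs)) (multiplicity-1-pairProducts xs)

-- Decomposition of binary partitions

powerOf2>0 : IsPowerOf2 m → m > 0
powerOf2>0 (k , refl) = m^n>0 2 k

halve-powerOf2 : IsPowerOf2 (2 * m) → IsPowerOf2 m
halve-powerOf2 {m} (zero  , eq) = contradiction eq (even≢odd m 0)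
halve-powerOf2 {m} (suc k , eq) = k , *-cancelˡ-≡ m (2 ^ k) 2 eq

∷ʳ-decreasing⁺ : Linked _≥_ xs → All (_> 0) xs → Linked _≥_ (xs ∷ʳ 1)
∷ʳ-decreasing⁺ []        []         = [-]
∷ʳ-decreasing⁺ [-]       (p ∷ [])   = p ∷ [-]
∷ʳ-decreasing⁺ (r ∷ xs↘) (_ ∷ ps)   = r ∷ ∷ʳ-decreasing⁺ xs↘ ps

∷ʳ-decreasing⁻ : ∀ xs → Linked _≥_ (xs ∷ʳ m) → Linked _≥_ xs
∷ʳ-decreasing⁻ []           _         = []
∷ʳ-decreasing⁻ (_ ∷ [])     _         = [-]
∷ʳ-decreasing⁻ (_ ∷ y ∷ xs) (r ∷ xs↘) = r ∷ ∷ʳ-decreasing⁻ (y ∷ xs) xs↘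

sum-∷ʳ : ∀ xs → sum (xs ∷ʳ 1) ≡ suc (sum xs)
sum-∷ʳ xs = trans (sum-++ xs (1 ∷ [])) (+-comm (sum xs) 1)

-- In a decreasing list of powers of 2 a part 1 can be found at the end; without it all exponents
-- are positive.
ones-or-even : Linked _≥_ xs → All IsPowerOf2 xs →
               (∃ λ ys → xs ≡ ys ∷ʳ 1) ⊎ (∃ λ ys → xs ≡ map (2 *_) ys)
ones-or-even []  []                      = inj₂ ([] , refl)
ones-or-even [-] ((zero  , refl) ∷ [])   = inj₁ ([] , refl)
ones-or-even [-] ((suc k , refl) ∷ [])   = inj₂ (2 ^ k ∷ [] , refl)
ones-or-even {x ∷ _} (x≥y ∷ xs↘) (px ∷ py ∷ pxs) with ones-or-even xs↘ (py ∷ pxs)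
... | inj₁ (ys , eq) = inj₁ (x ∷ ys , cong (x ∷_) eq)
ones-or-even (x≥y ∷ xs↘) ((suc k , refl) ∷ py ∷ pxs) | inj₂ (ys , eq) = inj₂ (2 ^ k ∷ ys , cong (2 ^ suc k ∷_) eq)
ones-or-even (x≥y ∷ xs↘) ((zero  , refl) ∷ py ∷ pxs) | inj₂ (h ∷ hs , refl) =
  -- A head 1 followed by a positive even part `2 * h` would force `2 * h ≡ 1`.
  contradiction (≤-antisym x≥y (powerOf2>0 py)) (even≢odd h 0)

∷ʳ-isBinaryPartition⁺ : IsBinaryPartition n xs → IsBinaryPartition (suc n) (xs ∷ʳ 1)
∷ʳ-isBinaryPartition⁺ {xs = xs} (isBinaryPartition (isPartition xs>0 xs↘ Σxs) pxs) =
  isBinaryPartition (isPartition (All.∷ʳ⁺ xs>0 (s≤s z≤n)) (∷ʳ-decreasing⁺ xs↘ xs>0) (trans (sum-∷ʳ xs) (cong suc Σxs)))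
                    (All.∷ʳ⁺ pxs (0 , refl))

∷ʳ-isBinaryPartition⁻ : ∀ xs → IsBinaryPartition (suc n) (xs ∷ʳ 1) → IsBinaryPartition n xs
∷ʳ-isBinaryPartition⁻ xs (isBinaryPartition (isPartition xs>0 xs↘ Σxs) pxs) =
  isBinaryPartition (isPartition (All.∷ʳ⁻ xs>0 .proj₁) (∷ʳ-decreasing⁻ xs xs↘) (suc-injective (trans (sym (sum-∷ʳ xs)) Σxs)))
                    (All.∷ʳ⁻ pxs .proj₁)

double-isBinaryPartition⁺ : IsBinaryPartition m xs → IsBinaryPartition (2 * m) (map (2 *_) xs)
double-isBinaryPartition⁺ {xs = xs} (isBinaryPartition (isPartition xs>0 xs↘ Σxs) pxs) =
  isBinaryPartition (isPartition (All.map⁺ (All.map (*-monoʳ-< 2) xs>0))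
                                 (Linked.map⁺ (Linked.map (*-monoʳ-≤ 2) xs↘))
                                 (trans (sum-map-* 2 xs) (cong (2 *_) Σxs)))
                    (All.map⁺ (All.map (λ (k , eq) → suc k , cong (2 *_) eq) pxs))

-- Taking `sum xs` as the size avoids dividing `n`. Positivity of the halves follows from their
-- being powers of 2.
double-isBinaryPartition⁻ : ∀ xs → IsBinaryPartition n (map (2 *_) xs) → IsBinaryPartition (sum xs) xs
double-isBinaryPartition⁻ xs (isBinaryPartition (isPartition _ xs↘ _) pxs) =
  isBinaryPartition (isPartition (All.map powerOf2>0 pxs′) (Linked.map (*-cancelˡ-≤ 2) (Linked.map⁻ xs↘)) refl) pxs′
  where
  pxs′ : All IsPowerOf2 xs
  pxs′ = All.map halve-powerOf2 (All.map⁻ pxs)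

withOne : ℕ → List (List ℕ)
withOne n = map (_∷ʳ 1) (binaryPartitions n)

allEven : ℕ → List (List ℕ)
allEven m = map (map (2 *_)) (binaryPartitions m)

withOne-unique : ∀ n → Unique (withOne n)
withOne-unique n = Unique.map⁺ (λ {xs} {ys} → ∷ʳ-injectiveˡ xs ys) (binaryPartitions-unique n)

∈-withOne⁺ : ∀ {xs} → IsBinaryPartition (suc n) (xs ∷ʳ 1) → xs ∷ʳ 1 ∈ withOne n
∈-withOne⁺ {xs = xs} p = ∈-map⁺ (_∷ʳ 1) (Equivalence.from (∈-binaryPartitions _) (∷ʳ-isBinaryPartition⁻ xs p))

withOne⊆ : ∀ {zs} → zs ∈ withOne n → zs ∈ binaryPartitions (suc n)
withOne⊆ {n} zs∈ with ys , ys∈ , refl ← ∈-map⁻ (_∷ʳ 1) zs∈ =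
  Equivalence.from (∈-binaryPartitions (suc n)) (∷ʳ-isBinaryPartition⁺ (Equivalence.to (∈-binaryPartitions n) ys∈))

binaryPartition-cases : ∀ {zs} → zs ∈ binaryPartitions (suc n) →
                        zs ∈ withOne n ⊎ (∃ λ m → suc n ≡ 2 * m × zs ∈ allEven m)
binaryPartition-cases {n} zs∈
  with p@(isBinaryPartition (isPartition _ zs↘ Σzs) pzs) ← Equivalence.to (∈-binaryPartitions (suc n)) zs∈
  with ones-or-even zs↘ pzs
... | inj₁ (ys , refl) = inj₁ (∈-withOne⁺ {n} p)
... | inj₂ (ys , refl) = inj₂ (sum ys , trans (sym Σzs) (sum-map-* 2 ys) ,
  ∈-map⁺ (map (2 *_)) (Equivalence.from (∈-binaryPartitions (sum ys)) (double-isBinaryPartition⁻ ys p)))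

-- Here `suc n` is odd, and an odd number has no partition into even parts.
binaryPartitions-odd : n ≡ 2 * m → binaryPartitions (suc n) ↭ withOne n
binaryPartitions-odd {n} {m} n≡2m = unique∧set⇒↭ (binaryPartitions-unique (suc n)) (withOne-unique n) ⊆ (withOne⊆ {n})
  where
  ⊆ : ∀ {zs} → zs ∈ binaryPartitions (suc n) → zs ∈ withOne n
  ⊆ zs∈ with binaryPartition-cases {n} zs∈
  ... | inj₁ zs∈′          = zs∈′
  ... | inj₂ (k , 1+n≡2k , _) = contradiction (trans (sym 1+n≡2k) (cong suc n≡2m)) (even≢odd k m)

binaryPartitions-even : suc n ≡ 2 * m → binaryPartitions (suc n) ↭ withOne n ++ allEven m
binaryPartitions-even {n} {m} 1+n≡2m = unique∧set⇒↭ (binaryPartitions-unique (suc n))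
  (Unique.++⁺ (withOne-unique n) allEven-unique disjoint) ⊆ ⊇
  where
  allEven-unique : Unique (allEven m)
  allEven-unique = Unique.map⁺ (map-injective (*-cancelˡ-≡ _ _ 2)) (binaryPartitions-unique m)

  disjoint : ∀ {zs} → ¬ (zs ∈ withOne n × zs ∈ allEven m)
  disjoint (zs∈ , zs∈′)
    with ys , _ , refl ← ∈-map⁻ (_∷ʳ 1) zs∈
    with ys′ , _ , eq ← ∈-map⁻ (map (2 *_)) zs∈′ =
    -- The number of ones tells the families apart: positive in the first, zero in the second.
    1+n≢0 (trans (sym (multiplicity-1-∷ʳ ys)) (trans (cong (multiplicity 1) eq) (multiplicity-1-map-* {2} (λ ()) ys′)))

  ⊆ : ∀ {zs} → zs ∈ binaryPartitions (suc n) → zs ∈ withOne n ++ allEven m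
  ⊆ zs∈ with binaryPartition-cases {n} zs∈
  ... | inj₁ zs∈′ = ∈-++⁺ˡ zs∈′
  ... | inj₂ (k , 1+n≡2k , zs∈′) =
    ∈-++⁺ʳ (withOne n) (subst (λ k → _ ∈ allEven k) (*-cancelˡ-≡ k m 2 (trans (sym 1+n≡2k) 1+n≡2m)) zs∈′)

  ⊇ : ∀ {zs} → zs ∈ withOne n ++ allEven m → zs ∈ binaryPartitions (suc n)
  ⊇ zs∈ with ∈-++⁻ (withOne n) zs∈
  ... | inj₁ zs∈′ = withOne⊆ {n} zs∈′
  ... | inj₂ zs∈′ with ys , ys∈ , refl ← ∈-map⁻ (map (2 *_)) zs∈′ =
    Equivalence.from (∈-binaryPartitions (suc n))
      (subst (λ k → IsBinaryPartition k (map (2 *_) ys)) (sym 1+n≡2m)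
        (double-isBinaryPartition⁺ (Equivalence.to (∈-binaryPartitions m) ys∈)))

-- Recurrences

sum-map-const : ∀ a (xs : List A) → sum (map (const a) xs) ≡ sum (map (const 1) xs) * a
sum-map-const a []       = refl
sum-map-const a (x ∷ xs) = cong (a +_) (sum-map-const a xs)

sum-map-+ : ∀ (f g : A → ℕ) xs → sum (map (λ x → f x + g x) xs) ≡ sum (map f xs) + sum (map g xs)
sum-map-+ f g []       = refl
sum-map-+ f g (x ∷ xs) = trans (cong (f x + g x +_) (sum-map-+ f g xs)) (interchange (f x) (g x) _ _)

β u c : ℕ → ℕ
β = onesSum (const 1)
u = onesSum id
c = onesSum (_C 2)

onesSum-withOne : ∀ f n → sum (map (f ∘ multiplicity 1) (withOne n)) ≡ onesSum (f ∘ suc) n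
onesSum-withOne f n = cong sum (trans (sym (map-∘ (binaryPartitions n)))
                                      (map-cong (cong f ∘ multiplicity-1-∷ʳ) (binaryPartitions n)))

onesSum-allEven : ∀ f m → sum (map (f ∘ multiplicity 1) (allEven m)) ≡ β m * f 0
onesSum-allEven f m = trans
  (cong sum (trans (sym (map-∘ (binaryPartitions m)))
                   (map-cong (cong f ∘ multiplicity-1-map-* {2} (λ ())) (binaryPartitions m))))
  (sum-map-const (f 0) (binaryPartitions m))

onesSum-odd : ∀ f → n ≡ 2 * m → onesSum f (suc n) ≡ onesSum (f ∘ suc) n
onesSum-odd {n} {m} f eq =
  trans (sum-↭ (↭.map⁺ (f ∘ multiplicity 1) (binaryPartitions-odd {m = m} eq))) (onesSum-withOne f n)

onesSum-even : ∀ f → suc n ≡ 2 * m → onesSum f (suc n) ≡ onesSum (f ∘ suc) n + β m * f 0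
onesSum-even {n} {m} f eq = begin
  onesSum f (suc n)
    ≡⟨ sum-↭ (↭.map⁺ g (binaryPartitions-even {m = m} eq)) ⟩
  sum (map g (withOne n ++ allEven m))
    ≡⟨ cong sum (map-++ g (withOne n) (allEven m)) ⟩
  sum (map g (withOne n) ++ map g (allEven m))
    ≡⟨ sum-++ (map g (withOne n)) (map g (allEven m)) ⟩
  sum (map g (withOne n)) + sum (map g (allEven m))
    ≡⟨ cong₂ _+_ (onesSum-withOne f n) (onesSum-allEven f m) ⟩
  onesSum (f ∘ suc) n + β m * f 0 ∎
  where
  open ≡-Reasoning
  g = f ∘ multiplicity 1

parity : ∀ n → n ≡ 2 * ⌊ n /2⌋ ⊎ suc n ≡ 2 * suc ⌊ n /2⌋
parity zero          = inj₁ refl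
parity (suc zero)    = inj₂ refl
parity (suc (suc n)) = Sum.map (λ eq → trans (cong (2 +_) eq) (sym (*-suc 2 ⌊ n /2⌋)))
                               (λ eq → trans (cong (2 +_) eq) (sym (*-suc 2 (suc ⌊ n /2⌋)))) (parity n)

-- Partitions without a part 1 have weight `f 0`, so if this vanishes the all-even family drops out
-- and both parities give the same formula.
onesSum-suc : ∀ f → f 0 ≡ 0 → ∀ n → onesSum f (suc n) ≡ onesSum (f ∘ suc) n
onesSum-suc f f0≡0 n with parity n
... | inj₁ eq = onesSum-odd {m = ⌊ n /2⌋} f eq
... | inj₂ eq = begin
  onesSum f (suc n)               ≡⟨ onesSum-even {m = k} f eq ⟩
  onesSum (f ∘ suc) n + β k * f 0 ≡⟨ cong (λ a → onesSum (f ∘ suc) n + β k * a) f0≡0 ⟩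
  onesSum (f ∘ suc) n + β k * 0   ≡⟨ cong (onesSum (f ∘ suc) n +_) (*-zeroʳ (β k)) ⟩
  onesSum (f ∘ suc) n + 0         ≡⟨ +-identityʳ _ ⟩
  onesSum (f ∘ suc) n             ∎
  where
  open ≡-Reasoning
  k = suc ⌊ n /2⌋

u-suc : ∀ n → u (suc n) ≡ u n + β n
u-suc n = trans (onesSum-suc id refl n)
         (trans (sum-map-+ (const 1) (multiplicity 1) (binaryPartitions n)) (+-comm (β n) (u n)))

-- The weight `_C 2` vanishes at 0, so only the removal of a 1 matters, and Pascal's rule splits the
-- shifted weight.
c-suc : ∀ n → c (suc n) ≡ c n + u n
c-suc n = begin
  c (suc n)                   ≡⟨ onesSum-suc (_C 2) refl n ⟩
  onesSum (λ k → suc k C 2) n ≡⟨ cong sum (map-cong (n+nC2≡[n+1]C2 ∘ multiplicity 1) (binaryPartitions n)) ⟨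
  onesSum (λ k → k + k C 2) n ≡⟨ sum-map-+ (multiplicity 1) ((_C 2) ∘ multiplicity 1) (binaryPartitions n) ⟩
  u n + c n                   ≡⟨ +-comm (u n) (c n) ⟩
  c n + u n                   ∎
  where open ≡-Reasoning

β-odd : n ≡ 2 * m → β (suc n) ≡ β n
β-odd {m = m} = onesSum-odd {m = m} (const 1)

β-even : suc n ≡ 2 * m → β (suc n) ≡ β n + β m
β-even {n} {m} eq = trans (onesSum-even {m = m} (const 1) eq) (cong (β n +_) (*-identityʳ (β m)))

-- Exactly one of `suc n` and `suc (suc n)` is even, and in either case its half is `suc ⌊ n /2⌋`;
-- only that step adds an all-even family.
β-suc-suc : ∀ n → β (suc (suc n)) ≡ β n + β (suc ⌊ n /2⌋)
β-suc-suc n with parity n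
... | inj₁ eq = trans (β-even {m = suc ⌊ n /2⌋} (trans (cong (2 +_) eq) (sym (*-suc 2 ⌊ n /2⌋))))
                      (cong (_+ β (suc ⌊ n /2⌋)) (β-odd {m = ⌊ n /2⌋} eq))
... | inj₂ eq = trans (β-odd {m = suc ⌊ n /2⌋} eq) (β-even {m = suc ⌊ n /2⌋} eq)

-- Induction in steps of two: both sides grow by `β (suc ⌊ n /2⌋)`.
β≡u : ∀ n → β n ≡ u (suc ⌊ n /2⌋)
β≡u zero          = refl
β≡u (suc zero)    = refl
β≡u (suc (suc n)) = begin
  β (suc (suc n))                   ≡⟨ β-suc-suc n ⟩
  β n + β (suc ⌊ n /2⌋)             ≡⟨ cong (_+ β (suc ⌊ n /2⌋)) (β≡u n) ⟩
  u (suc ⌊ n /2⌋) + β (suc ⌊ n /2⌋) ≡⟨ u-suc (suc ⌊ n /2⌋) ⟨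
  u (suc (suc ⌊ n /2⌋))             ∎
  where open ≡-Reasoning

-- Passing from `n` to `suc n` turns the ceiling into the new floor and raises the old floor by one
-- to the new ceiling. So only one `c` changes, and by `c-suc` and `β≡u` it grows by exactly `β n`.
u≡c+c : ∀ n → u n ≡ c (suc ⌊ n /2⌋) + c (suc ⌈ n /2⌉)
u≡c+c zero    = refl
u≡c+c (suc n) = begin
  u (suc n)                                           ≡⟨ u-suc n ⟩
  u n + β n                                           ≡⟨ cong₂ _+_ (u≡c+c n) (β≡u n) ⟩
  c (suc ⌊ n /2⌋) + c (suc ⌈ n /2⌉) + u (suc ⌊ n /2⌋) ≡⟨ xy∙z≈xz∙y (c (suc ⌊ n /2⌋)) _ _ ⟩
  c (suc ⌊ n /2⌋) + u (suc ⌊ n /2⌋) + c (suc ⌈ n /2⌉) ≡⟨ cong (_+ c (suc ⌈ n /2⌉)) (c-suc (suc ⌊ n /2⌋)) ⟨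
  c (suc (suc ⌊ n /2⌋)) + c (suc ⌈ n /2⌉)             ≡⟨ +-comm (c (suc (suc ⌊ n /2⌋))) _ ⟩
  c (suc ⌈ n /2⌉) + c (suc (suc ⌊ n /2⌋))             ∎
  where open ≡-Reasoning

recurrence : ∀ n → b₁,₂ (suc n) ≡ b₁,₂ n + b₁,₂ ⌊ suc n + 1 /2⌋ + b₁,₂ ⌈ suc n + 1 /2⌉
-- Once `n + 1` is `suc n`, the two halves reduce by computation to `suc ⌊ n /2⌋` and `suc ⌈ n /2⌉`.
recurrence n rewrite +-comm n 1 = begin
  b₁,₂ (suc n)                                     ≡⟨ b₁,₂≡onesSum (suc n) ⟩
  c (suc n)                                        ≡⟨ c-suc n ⟩
  c n + u n                                        ≡⟨ cong (c n +_) (u≡c+c n) ⟩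
  c n + (c (suc ⌊ n /2⌋) + c (suc ⌈ n /2⌉))        ≡⟨ +-assoc (c n) _ _ ⟨
  c n + c (suc ⌊ n /2⌋) + c (suc ⌈ n /2⌉)          ≡⟨ cong₂ _+_ (cong₂ _+_ (b₁,₂≡onesSum n) (b₁,₂≡onesSum (suc ⌊ n /2⌋))) (b₁,₂≡onesSum (suc ⌈ n /2⌉)) ⟨
  b₁,₂ n + b₁,₂ (suc ⌊ n /2⌋) + b₁,₂ (suc ⌈ n /2⌉) ∎
  where open ≡-Reasoning

theorem11 : b₁,₂ 1 ≡ 0
    × b₁,₂ 2 ≡ 1
    × (∀ (n : ℕ) → n ≥ 3 →
    b₁,₂ n ≡ b₁,₂ (n ∸ 1) + b₁,₂ ⌊ n + 1 /2⌋ + b₁,₂ ⌈ n + 1 /2⌉)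
-- Both initial values come from evaluating the enumeration.
theorem11 = refl , refl , λ { (suc n) _ → recurrence n }
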